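{- Let $k\in\{2,\dots,N\}$. For every forest $F\in\tilde{\mathcal F}^{k-1}$ and every atom $\mathcal E$ of the algebra $\mathfrak A_k$, the induced subgraph $F|_{\mathcal E}$ is a tree.
   Context: Let $V$ be a finite digraph with vertex set $\mathcal N$, $|\mathcal N|=N$, whose arcs $(i,j)$ carry real weights $v_{ij}$. An (entering) forest is a digraph in which at most one arc leaves each vertex and which contains no directed cycle; its weakly connected components are (entering) trees, the root of a tree being its unique vertex with no outgoing arc (a single vertex without arcs is a tree). A spanning forest is a subgraph of $V$ which is a forest with vertex set $\mathcal N$. For a subgraph $G$ of $V$ let $\Upsilon^G=\sum_{(i,j)\in\mathcal AG}v_{ij}$. Let $\mathcal F^k$ be the set of spanning forests with exactly $k$ trees, $\phi^k=\min_{F\in\mathcal F^k}\Upsilon^F$ ($\phi^k=\infty$ if $\mathcal F^k=\emptyset$), and $\tilde{\mathcal F}^k=\{F\in\mathcal F^k:\Upsilon^F=\phi^k\}$. Standing assumption: $V$ has at least one spanning tree. $\mathfrak A_k$ is the algebra of subsets of $\mathcal N$ generated (by complements and intersections) by the vertex sets of all trees of all forests in $\tilde{\mathcal F}^k$; an atom of $\mathfrak A_k$ is a nonempty $\mathcal A\in\mathfrak A_k$ with $\mathcal A\cap\mathcal B\in\{\emptyset,\mathcal A\}$ for all $\mathcal B\in\mathfrak A_k$. $G|_{\mathcal S}$ denotes the subgraph of $G$ induced by $\mathcal S\subseteq\mathcal N$. -}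

module Defs where

open import Level using (0ℓ)
open import Data.Nat using (ℕ; zero; suc) renaming (_+_ to _+ℕ_)
open import Data.Fin using (Fin)
import Data.Fin as Fin
open import Data.Maybe using (Maybe; just; nothing; maybe; _>>=_)
open import Data.Bool using (Bool; true)
open import Data.Product using (Σ; ∃; _×_; _,_)
open import Data.Sum using (_⊎_)
open import Data.Empty using (⊥)
open import Relation.Nullary using (¬_)
open import Relation.Binary.PropositionalEquality using (_≡_)
open import Relation.Binary.Construct.Closure.Equivalence using (EqClosure)
open import Function.Bundles using (_⇔_)

-- Totally ordered abelian group (the real numbers with + and ≤ are an instance).
-- Arc weights are taken in an arbitrary such group.
record OrderedAbelianGroup : Set₁ where
  infixl 6 _+_
  infix 4 _≤_
  field
    Carrier   : Set
    _+_       : Carrier → Carrier → Carrier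
    0#        : Carrier
    -_        : Carrier → Carrier
    _≤_       : Carrier → Carrier → Set
    +-assoc   : ∀ x y z → (x + y) + z ≡ x + (y + z)
    +-comm    : ∀ x y → x + y ≡ y + x
    +-identityˡ : ∀ x → 0# + x ≡ x
    -‿inverseˡ : ∀ x → (- x) + x ≡ 0#
    ≤-refl    : ∀ x → x ≤ x
    ≤-trans   : ∀ {x y z} → x ≤ y → y ≤ z → x ≤ z
    ≤-antisym : ∀ {x y} → x ≤ y → y ≤ x → x ≡ y
    ≤-total   : ∀ x y → x ≤ y ⊎ y ≤ x
    +-monoˡ-≤ : ∀ {x y} z → x ≤ y → x + z ≤ y + z

module _ (G : OrderedAbelianGroup) where
  open OrderedAbelianGroup G

  ∑ : ∀ {n} → (Fin n → Carrier) → Carrier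
  ∑ {zero}  f = 0#
  ∑ {suc n} f = f Fin.zero + ∑ (λ i → f (Fin.suc i))

-- A subgraph of V in which at most one arc leaves each vertex, on the full
-- vertex set Fin N, is encoded by its "successor" map: F i = just j means the
-- (unique) outgoing arc of i is (i , j); F i = nothing means no arc leaves i.
Sub : ℕ → Set
Sub N = Fin N → Maybe (Fin N)

iter : ∀ {N} → Sub N → ℕ → Maybe (Fin N) → Maybe (Fin N)
iter F zero    m = m
iter F (suc n) m = iter F n (m >>= F)

module _ {N : ℕ} (arc : Fin N → Fin N → Bool) where

  InV : Sub N → Set
  InV F = ∀ i j → F i ≡ just j → arc i j ≡ true

  -- no directed cycle (in a graph with out-degree ≤ 1 a directed cycle is
  -- exactly a vertex returning to itself after ≥ 1 steps)
  Acyclic : Sub N → Set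
  Acyclic F = ¬ (Σ (Fin N) λ i → Σ ℕ λ n → iter F (suc n) (just i) ≡ just i)

  SpanningForest : Sub N → Set
  SpanningForest F = InV F × Acyclic F

module _ {N : ℕ} where

  IsRoot : Sub N → Fin N → Set
  IsRoot F r = F r ≡ nothing

  InTree : Sub N → Fin N → Fin N → Set
  InTree F r i = Σ ℕ λ n → iter F n (just i) ≡ just r

  numTrees : Sub N → ℕ
  numTrees F = go (λ i → maybe (λ _ → 0) 1 (F i))
    where
    go : ∀ {n} → (Fin n → ℕ) → ℕ
    go {zero}  f = 0
    go {suc n} f = f Fin.zero +ℕ go (λ i → f (Fin.suc i))

  InducedArc : Sub N → (Fin N → Set) → Fin N → Fin N → Set
  InducedArc F E i j = E i × E j × F i ≡ just j

  -- F|_E is a tree (F|_E is automatically a forest, being a subgraph of the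
  -- forest F; a nonempty weakly connected forest is a tree)
  InducedIsTree : Sub N → (Fin N → Set) → Set
  InducedIsTree F E =
    (Σ (Fin N) E) ×
    (∀ i j → E i → E j → EqClosure (InducedArc F E) i j)

module Problem (G : OrderedAbelianGroup) {N : ℕ}
               (arc : Fin N → Fin N → Bool)
               (v : Fin N → Fin N → OrderedAbelianGroup.Carrier G) where
  open OrderedAbelianGroup G

  Υ : Sub N → Carrier
  Υ F = ∑ G (λ i → maybe (λ j → v i j) 0# (F i))

  InForests : ℕ → Sub N → Set
  InForests k F = SpanningForest arc F × numTrees F ≡ k

  Optimal : ℕ → Sub N → Set
  Optimal k F = InForests k F × (∀ H → InForests k H → Υ F ≤ Υ H)

  data InAlg (k : ℕ) : (Fin N → Set) → Set₁ where
    gen   : ∀ F r → Optimal k F → IsRoot F r → InAlg k (InTree F r)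
    compl : ∀ {P} → InAlg k P → InAlg k (λ i → ¬ P i)
    inter : ∀ {P Q} → InAlg k P → InAlg k Q → InAlg k (λ i → P i × Q i)
    ext   : ∀ {P Q} → InAlg k P → (∀ i → P i ⇔ Q i) → InAlg k Q

  IsAtom : ℕ → (Fin N → Set) → Set₁
  IsAtom k A =
    InAlg k A × (Σ (Fin N) A) ×
    (∀ B → InAlg k B → (∀ i → ¬ (A i × B i)) ⊎ (∀ i → A i → B i))

  HasSpanningTree : Set
  HasSpanningTree = Σ (Sub N) (InForests 1)

{-# OPTIONS --safe #-}

-- Give every root the weight λ = φ^(k-1) − φ^k. Exchanging arcs over a tree of
-- one forest that contains no root of another shows that φ is convex, so the
-- optimal forests with k − 1 and with k trees are exactly those with that many
-- trees among the forests of least total weight W. If two forests of least W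
-- exchange their arcs over a set of vertices and both results are forests, then
-- both are again of least W.
--
-- Two vertices lie in one atom iff no optimal k-forest separates them. Let x and
-- y in E be distinct vertices at which F leaves E, and suppose that F x = x′ and
-- that F does not lead y to x. Some optimal k-forest H separates x from x′, and
-- exchanges between F and H produce a forest of least W, with at least the roots
-- of H, which separates x from y. Exchanges with F lower its number of trees
-- down to k without uniting x and y, a contradiction. (If x and y are both roots
-- of F, a single exchange with an optimal k-forest already separates them.)

module Submission where

open import Defs
open import Data.Nat using (ℕ; _≤_; _∸_)
open import Data.Fin using (Fin)
open import Data.Bool using (Bool)

open import Data.Bool using (if_then_else_)
open import Data.Empty using (⊥; ⊥-elim)
open import Data.Fin using (punchIn; toℕ)
open import Data.Fin.Properties using (_≟_; any?; all?; punchInᵢ≢i; pigeonhole; toℕ<n)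
open import Data.Maybe using (Maybe; just; nothing; maybe; _>>=_)
open import Data.Maybe.Properties using (just-injective) renaming (≡-dec to Maybe-≡-dec)
open import Data.Nat as ℕ using (zero; suc; _<_; z≤n; s≤s)
open import Data.Nat.Induction using (<-wellFounded)
import Data.Nat.Properties as ℕₚ
open import Data.Nat.Properties
  using (+-0-commutativeMonoid; +-mono-≤; +-mono-<-≤; ≤-reflexive; ≤-trans; *-identityʳ; *-zeroʳ;
         *-distribˡ-+; m≤m+n; m+[n∸m]≡n; n<1+n; ≤-pred; ≤⇒≯; suc-injective;
         m≤n⇒∃[o]m+o≡n; +-suc; +-identityʳ; ≤-<-connex)
open import Data.Product using (∃; ∃₂; _×_; _,_; _,′_; proj₁; proj₂)
open import Data.Sum using (_⊎_; inj₁; inj₂; [_,_]′)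
open import Function using (_∘_; case_of_; id)
open import Function.Bundles using (module Equivalence)
open import Induction.WellFounded using (Acc; acc)
open import Relation.Nullary
  using (¬_; Dec; yes; no; does; contradiction; ¬?; _×-dec_; _→-dec_; _⊎-dec_; map′)
open import Relation.Unary using (Decidable)
open import Relation.Binary.Construct.Closure.Equivalence using (EqClosure; return; symmetric; transitive)
open import Relation.Binary.Construct.Closure.ReflexiveTransitive using (ε)
open import Relation.Binary.PropositionalEquality
  using (_≡_; _≢_; refl; sym; trans; cong; cong₂; subst; subst₂; module ≡-Reasoning)
open import Algebra.Properties.CommutativeMonoid.Sum +-0-commutativeMonoid
  using (sum; sum-remove; sum-cong-≗; sum-replicate-zero; ∑-comm)

-- Finite sums of naturals and indicators.

sum-mono-≤ : ∀ {n} {f g : Fin n → ℕ} → (∀ i → f i ≤ g i) → sum f ≤ sum g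
sum-mono-≤ {zero}  f≤g = z≤n
sum-mono-≤ {suc n} f≤g = +-mono-≤ (f≤g Fin.zero) (sum-mono-≤ (λ i → f≤g (Fin.suc i)))

sum-mono-< : ∀ {n} {f g : Fin n → ℕ} i → (∀ j → f j ≤ g j) → f i < g i → sum f < sum g
sum-mono-< {suc n} {f} {g} i f≤g fi<gi
  rewrite sum-remove {i = i} f | sum-remove {i = i} g =
  +-mono-<-≤ fi<gi (sum-mono-≤ (λ j → f≤g (punchIn i j)))

term≤sum : ∀ {n} (f : Fin n → ℕ) i → f i ≤ sum f
term≤sum {suc n} f i rewrite sum-remove {i = i} f = m≤m+n _ _

sum-suc : ∀ {n} {f g : Fin n → ℕ} i → (∀ j → j ≢ i → f j ≡ g j) →
          suc (f i) ≡ g i → suc (sum f) ≡ sum g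
sum-suc {suc n} {f} {g} i f≡g eq rewrite sum-remove {i = i} f | sum-remove {i = i} g =
  cong₂ ℕ._+_ eq (sum-cong-≗ (λ j → f≡g (punchIn i j) (punchInᵢ≢i i j)))

sum-*ˡ : ∀ {n} c (f : Fin n → ℕ) → sum (λ i → c ℕ.* f i) ≡ c ℕ.* sum f
sum-*ˡ {zero}  c f = sym (*-zeroʳ c)
sum-*ˡ {suc n} c f = trans (cong (c ℕ.* f Fin.zero ℕ.+_) (sum-*ˡ c (f ∘ Fin.suc)))
                           (sym (*-distribˡ-+ c (f Fin.zero) _))

⟦_⟧ : {P : Set} → Dec P → ℕ
⟦ p ⟧ = if does p then 1 else 0

⟦⟧-yes : {P : Set} (p : Dec P) → P → ⟦ p ⟧ ≡ 1
⟦⟧-yes (yes _) _ = refl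
⟦⟧-yes (no ¬p) p = contradiction p ¬p

⟦⟧-no : {P : Set} (p : Dec P) → ¬ P → ⟦ p ⟧ ≡ 0
⟦⟧-no (yes p) ¬p = contradiction p ¬p
⟦⟧-no (no _) _ = refl

⟦⟧-mono : {P Q : Set} (p : Dec P) (q : Dec Q) → (P → Q) → ⟦ p ⟧ ≤ ⟦ q ⟧
⟦⟧-mono (no _)  q f = z≤n
⟦⟧-mono (yes p) q f = ≤-reflexive (sym (⟦⟧-yes q (f p)))

sum-⟦≟⟧ : ∀ {n} (i : Fin n) → sum (λ j → ⟦ i ≟ j ⟧) ≡ 1
sum-⟦≟⟧ {suc n} i rewrite sum-remove {i = i} (λ j → ⟦ i ≟ j ⟧) | ⟦⟧-yes (i ≟ i) refl =
  cong suc (trans (sum-cong-≗ (λ j → ⟦⟧-no (i ≟ punchIn i j) (punchInᵢ≢i i j ∘ sym)))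
                  (sum-replicate-zero n))

-- The local function `go` of `numTrees` is not in scope; `solve` forces the
-- unifier to instantiate the body of `count` with it. This serves every `Sub`,
-- because conversion ignores the forest on which `go` vacuously depends.
mutual
  count : ∀ n → (Fin n → ℕ) → ℕ
  count n w = _

  solve : ∀ n → numTrees {n} (λ _ → nothing) ≡ count n (λ _ → 1)
  solve n with (λ (i : Fin n) → 1)
  ... | w = refl {x = count n w}

count≡sum : ∀ n (w : Fin n → ℕ) → count n w ≡ sum w
count≡sum zero    w = refl
count≡sum (suc n) w = cong (w Fin.zero ℕ.+_) (count≡sum n _)

isRoot : {A : Set} → Maybe A → ℕ
isRoot = maybe (λ _ → 0) 1

numTrees≡sum : ∀ {N} (F : Sub N) → numTrees F ≡ sum (isRoot ∘ F)
numTrees≡sum {N} F = count≡sum N _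

isRoot≡0 : {A : Set} {m : Maybe A} → m ≢ nothing → isRoot m ≡ 0
isRoot≡0 {m = just _}  _ = refl
isRoot≡0 {m = nothing} h = contradiction refl h

isRoot≡1 : {A : Set} {m : Maybe A} → m ≡ nothing → isRoot m ≡ 1
isRoot≡1 refl = refl

is-nothing? : {A : Set} (m : Maybe A) → Dec (m ≡ nothing)
is-nothing? nothing  = yes refl
is-nothing? (just _) = no λ ()

isRoot-cong : {A : Set} {m m′ : Maybe A} → (m ≡ nothing → m′ ≡ nothing) → (m′ ≡ nothing → m ≡ nothing) →
              isRoot m ≡ isRoot m′
isRoot-cong {m = m} f g with is-nothing? m
... | yes p = trans (isRoot≡1 p) (sym (isRoot≡1 (f p)))
... | no ¬p = trans (isRoot≡0 ¬p) (sym (isRoot≡0 (¬p ∘ g)))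

-- Walks, roots and forests of a successor map.

module _ {N : ℕ} where

  numTrees-suc : ∀ (X B : Sub N) r → X r ≢ nothing → B r ≡ nothing →
                 (∀ z → z ≢ r → X z ≡ nothing → B z ≡ nothing) →
                 (∀ z → z ≢ r → B z ≡ nothing → X z ≡ nothing) →
                 suc (numTrees X) ≡ numTrees B
  numTrees-suc X B r Xr Br X⇒B B⇒X rewrite numTrees≡sum X | numTrees≡sum B =
    sum-suc r (λ z z≢r → isRoot-cong (X⇒B z z≢r) (B⇒X z z≢r))
      (trans (cong suc (isRoot≡0 Xr)) (sym (isRoot≡1 Br)))

  numTrees-mono : ∀ (X B : Sub N) → (∀ z → X z ≡ nothing → B z ≡ nothing) → numTrees X ≤ numTrees B
  numTrees-mono X B X⇒B rewrite numTrees≡sum X | numTrees≡sum B = sum-mono-≤ le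
    where
    le : ∀ z → isRoot (X z) ≤ isRoot (B z)
    le z with is-nothing? (X z)
    ... | yes p = ≤-reflexive (trans (isRoot≡1 p) (sym (isRoot≡1 (X⇒B z p))))
    ... | no ¬p rewrite isRoot≡0 ¬p = z≤n

  _≟ₘ_ : (m m′ : Maybe (Fin N)) → Dec (m ≡ m′)
  _≟ₘ_ = Maybe-≡-dec _≟_

  -- The measure on which the repeated exchanges in `separate` and `drop` terminate.
  dist : Sub N → Sub N → ℕ
  dist F H = sum (λ z → ⟦ ¬? (F z ≟ₘ H z) ⟧)

  dist-< : ∀ {F G H : Sub N} → (∀ z → G z ≡ H z ⊎ G z ≡ F z) →
           ∀ t → G t ≡ H t → F t ≢ H t → dist G H < dist F H
  dist-< {F} {G} {H} between t Gt Ft = sum-mono-< t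
    (λ z → ⟦⟧-mono (¬? (G z ≟ₘ H z)) (¬? (F z ≟ₘ H z))
      (λ G≢H F≡H → [ G≢H , (λ G≡F → G≢H (trans G≡F F≡H)) ]′ (between z)))
    (subst (_< ⟦ ¬? (F t ≟ₘ H t) ⟧) (sym (⟦⟧-no (¬? (G t ≟ₘ H t)) (λ ne → ne Gt)))
      (≤-reflexive (sym (⟦⟧-yes (¬? (F t ≟ₘ H t)) Ft))))

  data Root (G : Sub N) : Fin N → Fin N → Set where
    stop : ∀ {r} → G r ≡ nothing → Root G r r
    step : ∀ {z z′ r} → G z ≡ just z′ → Root G z′ r → Root G z r

  data Path (G : Sub N) : Fin N → Fin N → Set where
    here : ∀ {x} → Path G x x
    step : ∀ {z z′ x} → G z ≡ just z′ → Path G z′ x → Path G z x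

  -- On finitely many vertices this is acyclicity; the inductive `Root` supplies a walk to recurse
  -- on.
  Forest : Sub N → Set
  Forest G = ∀ z → ∃ (Root G z)

  module _ {G : Sub N} where

    just≢nothing : ∀ {z z′} → G z ≡ just z′ → G z ≢ nothing
    just≢nothing p q with trans (sym p) q
    ... | ()

    just-unique : ∀ {z x y} → G z ≡ just x → G z ≡ just y → x ≡ y
    just-unique p q = just-injective (trans (sym p) q)

    root-nothing : ∀ {z r} → Root G z r → G r ≡ nothing
    root-nothing (stop e)   = e
    root-nothing (step _ p) = root-nothing p

    root-unique : ∀ {z r s} → Root G z r → Root G z s → r ≡ s
    root-unique (stop e)   (stop _)    = refl
    root-unique (stop e)   (step e′ _) = contradiction e (just≢nothing e′)
    root-unique (step e _) (stop e′)   = contradiction e′ (just≢nothing e)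
    root-unique (step e p) (step e′ q) with refl ← just-unique e e′ = root-unique p q

    root-next : ∀ {z z′ r} → G z ≡ just z′ → Root G z r → Root G z′ r
    root-next e (stop e′)   = contradiction e′ (just≢nothing e)
    root-next e (step e′ p) with refl ← just-unique e e′ = p

    path-root : ∀ {z x r} → Path G z x → Root G x r → Root G z r
    path-root here       q = q
    path-root (step e p) q = step e (path-root p q)

    path-root⁻ : ∀ {z x r} → Path G z x → Root G z r → Root G x r
    path-root⁻ here       q = q
    path-root⁻ (step e p) q = path-root⁻ p (root-next e q)

    path? : ∀ {z r} → Root G z r → ∀ x → Dec (Path G z x)
    path? {z} p x with z ≟ x
    ... | yes refl = yes here
    path? (stop e)   x | no z≢x = no λ { here → z≢x refl ; (step e′ _) → just≢nothing e′ e }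
    path? (step e p) x | no z≢x =
      map′ (step e) (λ { here → contradiction refl z≢x
                       ; (step e′ q) → subst (λ y → Path G y x) (just-unique e′ e) q }) (path? p x)

    root? : Forest G → ∀ z r → Dec (Root G z r)
    root? f z r with f z
    ... | s , p with s ≟ r
    ...   | yes refl = yes p
    ...   | no s≢r   = no (s≢r ∘ root-unique p)

    path-trans : ∀ {x y z} → Path G x y → Path G y z → Path G x z
    path-trans here       q = q
    path-trans (step e p) q = step e (path-trans p q)

    path-antisym : ∀ {x y r} → Root G x r → Path G x y → Path G y x → x ≡ y
    path-antisym _          here       _ = refl
    path-antisym (stop e)   (step e′ _) _ = contradiction e (just≢nothing e′)
    path-antisym {x} (step e q) (step e′ p) p′ with refl ← just-unique e e′ =
      contradiction (path-trans p p′) (no-cycle q e)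
      where
      -- The base of the cycle moves along the walk to the root, which no arc leaves.
      no-cycle : ∀ {z z′ r} → Root G z′ r → G z ≡ just z′ → ¬ Path G z′ z
      no-cycle (stop e₁)   e here        = just≢nothing e e₁
      no-cycle (stop e₁)   e (step e₂ _) = just≢nothing e₂ e₁
      no-cycle (step e₁ q) e here with refl ← just-unique e₁ e = no-cycle q e here
      no-cycle (step e₁ q) e (step e₂ p) with refl ← just-unique e₁ e₂ =
        no-cycle q e₁ (path-trans p (step e here))

  -- A walk of `H` that starts in the closed set `P` stays there, where `G` has the same arcs.
  root-agree : ∀ {G H : Sub N} (P : Fin N → Set) →
               (∀ {z z′} → P z → H z ≡ just z′ → P z′) → (∀ {z} → P z → G z ≡ H z) →
               ∀ {z r} → P z → Root H z r → Root G z r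
  root-agree P closed agree Pz (stop e)   = stop (trans (agree Pz) e)
  root-agree P closed agree Pz (step e p) =
    step (trans (agree Pz) e) (root-agree P closed agree (closed Pz e) p)

  -- The walk of `A` is followed until it ends or first meets `U`, where `inU` takes over.
  forest-extend : ∀ {A G : Sub N} {U : Fin N → Set} → Decidable U →
                  (∀ {z} → ¬ U z → G z ≡ A z) → (∀ {z} → U z → ∃ (Root G z)) → Forest A → Forest G
  forest-extend {A} {G} {U} U? agree inU fA z = extend (proj₂ (fA z))
    where
    extend : ∀ {z r} → Root A z r → ∃ (Root G z)
    extend {z} p with U? z
    ... | yes Uz = inU Uz
    extend (stop e)   | no ¬Uz = _ , stop (trans (agree ¬Uz) e)
    extend (step e p) | no ¬Uz = _ , step (trans (agree ¬Uz) e) (proj₂ (extend p))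

  -- Exchanging arcs over a set of vertices.

  mix : {U : Fin N → Set} → Decidable U → Sub N → Sub N → Sub N
  mix U? A B z = if does (U? z) then A z else B z

  module _ {U : Fin N → Set} (U? : Decidable U) (A B : Sub N) where

    mix-in : ∀ {z} → U z → mix U? A B z ≡ A z
    mix-in {z} u with U? z
    ... | yes _ = refl
    ... | no ¬u = contradiction u ¬u

    mix-out : ∀ {z} → ¬ U z → mix U? A B z ≡ B z
    mix-out {z} ¬u with U? z
    ... | yes u = contradiction u ¬u
    ... | no _  = refl

    mix-either : ∀ z → mix U? A B z ≡ A z ⊎ mix U? A B z ≡ B z
    mix-either z with U? z
    ... | yes _ = inj₁ refl
    ... | no _  = inj₂ refl

  -- Exchanging the arcs over such a tree moves one root: `A` gains `r` and `B` loses it.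
  Free : Sub N → Sub N → Fin N → Set
  Free A B r = B r ≡ nothing × (∀ z → Root B z r → A z ≢ nothing)

  -- Pigeonhole: if every tree of `B` contained a root of `A`, then `B` would have at most as many
  -- trees as `A`.
  free-tree : ∀ {A B : Sub N} → Forest B → numTrees A < numTrees B → ∃ (Free A B)
  free-tree {A} {B} fB A<B with any? free?
    where
    free? : Decidable (Free A B)
    free? r = is-nothing? (B r) ×-dec all? (λ z → root? fB z r →-dec ¬? (is-nothing? (A z)))
  ... | yes p = p
  ... | no ¬free = contradiction A<B (≤⇒≯ B≤A)
    where
    open ℕₚ.≤-Reasoning
    root : Fin N → Fin N
    root z = proj₁ (fB z)

    rootOfA : ∀ r → B r ≡ nothing → ∃ λ z → Root B z r × A z ≡ nothing
    rootOfA r Br with any? (λ z → root? fB z r ×-dec is-nothing? (A z))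
    ... | yes p = p
    ... | no ¬p = contradiction (r , Br , λ z p q → ¬p (z , p , q)) ¬free

    le : ∀ r → isRoot (B r) ≤ sum (λ z → isRoot (A z) ℕ.* ⟦ root z ≟ r ⟧)
    le r with is-nothing? (B r)
    ... | no ¬p rewrite isRoot≡0 ¬p = z≤n
    ... | yes p with z , q , Az ← rootOfA r p = ≤-trans
      (≤-reflexive (trans (isRoot≡1 p) (sym (cong₂ ℕ._*_ (isRoot≡1 Az)
        (⟦⟧-yes (root z ≟ r) (root-unique (proj₂ (fB z)) q))))))
      (term≤sum (λ z → isRoot (A z) ℕ.* ⟦ root z ≟ r ⟧) z)

    -- Double counting of the pairs of a root `z` of `A` and the root `r` to which `B` leads `z`:
    -- each `z` has just one such `r`.
    B≤A : numTrees B ≤ numTrees A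
    B≤A = begin
      numTrees B                                                    ≡⟨ numTrees≡sum B ⟩
      sum (λ r → isRoot (B r))                                      ≤⟨ sum-mono-≤ le ⟩
      sum (λ r → sum (λ z → isRoot (A z) ℕ.* ⟦ root z ≟ r ⟧))       ≡⟨
        ∑-comm {N} {N} (λ r z → isRoot (A z) ℕ.* ⟦ root z ≟ r ⟧) ⟩
      sum (λ z → sum (λ r → isRoot (A z) ℕ.* ⟦ root z ≟ r ⟧))       ≡⟨ sum-cong-≗ (λ z →
        trans (sum-*ˡ (isRoot (A z)) (λ r → ⟦ root z ≟ r ⟧))
          (trans (cong (isRoot (A z) ℕ.*_) (sum-⟦≟⟧ (root z))) (*-identityʳ _))) ⟩
      sum (λ z → isRoot (A z))                                      ≡⟨ numTrees≡sum A ⟨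
      numTrees A                                                    ∎

  -- Iterated successors versus inductive walks.

  iter-nothing : ∀ (F : Sub N) n → iter F n nothing ≡ nothing
  iter-nothing F zero    = refl
  iter-nothing F (suc n) = iter-nothing F n

  iter-+ : ∀ (F : Sub N) m n x → iter F (m ℕ.+ n) x ≡ iter F n (iter F m x)
  iter-+ F zero    n x = refl
  iter-+ F (suc m) n x = iter-+ F m n (x >>= F)

  inTree⇒root : ∀ {F r} → F r ≡ nothing → ∀ {i} → InTree F r i → Root F i r
  inTree⇒root {F} {r} Fr (n , eq) = go n eq
    where
    go : ∀ n {i} → iter F n (just i) ≡ just r → Root F i r
    go zero    refl = stop Fr
    go (suc n) {i} eq with F i in Fi
    ... | just j  = step Fi (go n eq)
    ... | nothing = contradiction (trans (sym (iter-nothing F n)) eq) λ ()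

  root⇒inTree : ∀ {F i r} → Root F i r → InTree F r i
  root⇒inTree (stop _) = 0 , refl
  root⇒inTree {F} (step {z′ = j} e p) with n , eq ← root⇒inTree p =
    suc n , trans (cong (iter F n) e) eq

  forest⇒acyclic : ∀ {arc : Fin N → Fin N → Bool} {F} → Forest F → Acyclic arc F
  forest⇒acyclic {arc} {F} fF (i , n , eq) = no-return (proj₂ (fF i)) n eq
    where
    no-return : ∀ {i r} → Root F i r → ∀ n → iter F (suc n) (just i) ≢ just i
    no-return (stop e) n eq =
      contradiction (trans (sym (iter-nothing F n)) (trans (cong (iter F n) (sym e)) eq)) λ ()
    no-return {i} (step {z′ = j} e p) n eq = no-return p n (begin
      iter F (suc n) (just j)         ≡⟨ cong (λ m → iter F m (just j)) (ℕₚ.+-comm 1 n) ⟩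
      iter F (n ℕ.+ 1) (just j)       ≡⟨ iter-+ F n 1 (just j) ⟩
      iter F 1 (iter F n (just j))    ≡⟨ cong (λ m → iter F 1 (iter F n m)) e ⟨
      iter F 1 (iter F n (F i))       ≡⟨ cong (iter F 1) eq ⟩
      F i                             ≡⟨ e ⟩
      just j                          ∎)
      where
      open ≡-Reasoning

  -- A walk that has not ended after `N` steps has visited `N + 1` vertices; two of them coincide,
  -- and the walk between them is a cycle.
  acyclic⇒forest : ∀ {arc : Fin N → Fin N → Bool} {F} → Acyclic arc F → Forest F
  acyclic⇒forest {arc} {F} acyclic z with runs N z
    where
    runs : ∀ n z → ∃ (Root F z) ⊎ (∀ m → m ≤ n → ∃ λ y → iter F m (just z) ≡ just y)
    runs n z with F z in Fz
    runs n z | nothing = inj₁ (z , stop Fz)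
    runs zero z | just y = inj₂ λ { zero z≤n → z , refl }
    runs (suc n) z | just y with runs n y
    ... | inj₁ (r , p) = inj₁ (r , step Fz p)
    ... | inj₂ h = inj₂ λ { zero _ → z , refl
                          ; (suc m) (s≤s m≤n) → proj₁ (h m m≤n) , trans (cong (iter F m) Fz) (proj₂ (h m m≤n)) }
  ... | inj₁ p = p
  ... | inj₂ h = ⊥-elim (cycle (pigeonhole (n<1+n N) (λ i → proj₁ (at i))))
    where
    at : (i : Fin (suc N)) → ∃ λ y → iter F (toℕ i) (just z) ≡ just y
    at i = h (toℕ i) (≤-pred (toℕ<n i))

    cycle : (∃₂ λ i j → toℕ i < toℕ j × proj₁ (at i) ≡ proj₁ (at j)) → ⊥
    cycle (i , j , i<j , eq) = acyclic (proj₁ (at i) , d , (begin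
      iter F (suc d) (just (proj₁ (at i)))        ≡⟨ cong (iter F (suc d)) (proj₂ (at i)) ⟨
      iter F (suc d) (iter F (toℕ i) (just z))    ≡⟨ iter-+ F (toℕ i) (suc d) (just z) ⟨
      iter F (toℕ i ℕ.+ suc d) (just z)           ≡⟨
        cong (λ m → iter F m (just z)) (trans (+-suc (toℕ i) d) (m+[n∸m]≡n i<j)) ⟩
      iter F (toℕ j) (just z)                     ≡⟨ proj₂ (at j) ⟩
      just (proj₁ (at j))                         ≡⟨ cong just eq ⟨
      just (proj₁ (at i))                         ∎))
      where
      open ≡-Reasoning
      -- `Acyclic` counts `suc n` steps, so the cycle length `toℕ j ∸ toℕ i` is written as `suc d`.
      d = toℕ j ∸ suc (toℕ i)

-- Exchanges over a tree and over a branch.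

module _ {N : ℕ} where

  Sep : Sub N → Fin N → Fin N → Set
  Sep G u v = ∃₂ λ r s → Root G u r × Root G v s × r ≢ s

  sep-sym : ∀ {G u v} → Sep G u v → Sep G v u
  sep-sym (r , s , p , q , r≢s) = s , r , q , p , r≢s ∘ sym

  OffTree : Sub N → Fin N → Sub N → Set
  OffTree H r X = ∀ {z} → ¬ Root H z r → X z ≡ H z

  off-root : ∀ {H X r} → OffTree H r X → ∀ {z s} → ¬ Root H z r → Root H z s → Root X z s
  off-root {H} {X} {r} off = root-agree (λ z → ¬ Root H z r) (λ ¬p e p → ¬p (step e p)) off

  module TreeExchange {F H : Sub N} (fF : Forest F) (fH : Forest H) (r : Fin N) where

    D : Fin N → Set
    D z = Root H z r

    D? : Decidable D
    D? z = root? fH z r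

    H-on-F-off F-on-H-off : Sub N
    H-on-F-off = mix D? H F
    F-on-H-off = mix D? F H

    H-on-in : ∀ {z} → D z → H-on-F-off z ≡ H z
    H-on-in = mix-in D? H F

    H-on-out : ∀ {z} → ¬ D z → H-on-F-off z ≡ F z
    H-on-out = mix-out D? H F

    F-on-in : ∀ {z} → D z → F-on-H-off z ≡ F z
    F-on-in = mix-in D? F H

    F-on-off : OffTree H r F-on-H-off
    F-on-off = mix-out D? F H

    H-on-root : ∀ {z} → D z → Root H-on-F-off z r
    H-on-root Dz = root-agree D (λ p e → root-next e p) H-on-in Dz Dz

    -- No arc of `H` leaves `D`, so walks in `D` end at `r`; elsewhere the walk of `F` ends or
    -- enters `D`.
    H-on-forest : Forest H-on-F-off
    H-on-forest = forest-extend D? H-on-out (λ Dz → r , H-on-root Dz) fF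

    -- No arc of `H` enters `D`, so walks outside end as in `H`; inside, the walk of `F` ends or
    -- leaves `D`.
    F-on-forest : Forest F-on-H-off
    F-on-forest = forest-extend (¬? ∘ D?) on (λ ¬Dz → _ , off-root F-on-off ¬Dz (proj₂ (fH _))) fF
      where
      on : ∀ {z} → ¬ ¬ D z → F-on-H-off z ≡ F z
      on {z} ¬¬Dz with D? z
      ... | yes _  = refl
      ... | no ¬Dz = contradiction ¬Dz ¬¬Dz

    module _ (free : Free F H r) where

      numTrees-H-on : numTrees H-on-F-off ≡ suc (numTrees F)
      numTrees-H-on = sym (numTrees-suc F H-on-F-off r (proj₂ free r Dr)
        (trans (H-on-in Dr) (proj₁ free)) F⇒ ⇒F)
        where
        Dr = stop (proj₁ free)
        F⇒ : ∀ z → z ≢ r → F z ≡ nothing → H-on-F-off z ≡ nothing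
        F⇒ z z≢r Fz with D? z
        ... | yes Dz = contradiction Fz (proj₂ free z Dz)
        ... | no ¬Dz = Fz
        ⇒F : ∀ z → z ≢ r → H-on-F-off z ≡ nothing → F z ≡ nothing
        ⇒F z z≢r eq with D? z
        ... | yes Dz = contradiction (root-unique (stop eq) Dz) z≢r
        ... | no ¬Dz = eq

      numTrees-F-on : suc (numTrees F-on-H-off) ≡ numTrees H
      numTrees-F-on = numTrees-suc F-on-H-off H r
        (λ eq → proj₂ free r Dr (trans (sym (F-on-in Dr)) eq)) (proj₁ free) ⇒H H⇒
        where
        Dr = stop (proj₁ free)
        ⇒H : ∀ z → z ≢ r → F-on-H-off z ≡ nothing → H z ≡ nothing
        ⇒H z z≢r eq with D? z
        ... | yes Dz = contradiction eq (proj₂ free z Dz)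
        ... | no ¬Dz = eq
        H⇒ : ∀ z → z ≢ r → H z ≡ nothing → F-on-H-off z ≡ nothing
        H⇒ z z≢r eq with D? z
        ... | yes Dz = contradiction (root-unique (stop eq) Dz) z≢r
        ... | no ¬Dz = eq

  -- The tree D of H behaves like a graph whose outside is a single sink, and
  -- the set C of vertices that Q leads to u is a tree of Q in it.
  module BranchExchange {Q H : Sub N} (fQ : Forest Q) (fH : Forest H) {r : Fin N}
                        (Q-off : OffTree H r Q) {u u′ : Fin N} (Qu : Q u ≡ just u′)
                        (Du : Root H u r) (¬Du′ : ¬ Root H u′ r) where

    C : Fin N → Set
    C z = Path Q z u

    C? : Decidable C
    C? z = path? (proj₂ (fQ z)) u

    -- Outside `D` the arcs of `Q` are those of `H`, and none of them enters `D`, where `u` lies.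
    C⊆D : ∀ {z} → C z → Root H z r
    C⊆D {z} p with root? fH z r
    ... | yes Dz = Dz
    C⊆D here       | no ¬Dz = contradiction Du ¬Dz
    C⊆D (step e p) | no ¬Dz = step (trans (sym (Q-off ¬Dz)) e) (C⊆D p)

    Q-on-H-off H-on-Q-off : Sub N
    Q-on-H-off = mix C? Q H
    H-on-Q-off = mix C? H Q

    Q-on-in : ∀ {z} → C z → Q-on-H-off z ≡ Q z
    Q-on-in = mix-in C? Q H

    Q-on-out : ∀ {z} → ¬ C z → Q-on-H-off z ≡ H z
    Q-on-out = mix-out C? Q H

    H-on-in : ∀ {z} → C z → H-on-Q-off z ≡ H z
    H-on-in = mix-in C? H Q

    H-on-out : ∀ {z} → ¬ C z → H-on-Q-off z ≡ Q z
    H-on-out = mix-out C? H Q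

    Q-on-off : OffTree H r Q-on-H-off
    Q-on-off ¬Dz = Q-on-out (¬Dz ∘ C⊆D)

    H-on-off : OffTree H r H-on-Q-off
    H-on-off ¬Dz = trans (H-on-out (¬Dz ∘ C⊆D)) (Q-off ¬Dz)

    exit : Fin N
    exit = proj₁ (fH u′)

    exit-root : Root H u′ exit
    exit-root = proj₂ (fH u′)

    -- Within `C` the arcs of `Q` lead to `u` and on to `u′`; that vertex lies outside `D`, where
    -- the walk is that of `H`.
    Q-on-root : ∀ {z} → C z → Root Q-on-H-off z exit
    Q-on-root here       = step (trans (Q-on-in here) Qu) (off-root Q-on-off ¬Du′ exit-root)
    Q-on-root (step e p) = step (trans (Q-on-in (step e p)) e) (Q-on-root p)

    H-off-root : ∀ {z s} → ¬ C z → Root Q z s → Root H-on-Q-off z s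
    H-off-root = root-agree (λ z → ¬ C z) (λ ¬Cz e Cz′ → ¬Cz (step e Cz′)) H-on-out

    Q-on-forest : Forest Q-on-H-off
    Q-on-forest = forest-extend C? Q-on-out (λ Cz → exit , Q-on-root Cz) fH

    H-on-forest : Forest H-on-Q-off
    H-on-forest = forest-extend (¬? ∘ C?) on (λ ¬Cz → _ , H-off-root ¬Cz (proj₂ (fQ _))) fH
      where
      on : ∀ {z} → ¬ ¬ C z → H-on-Q-off z ≡ H z
      on {z} ¬¬Cz with C? z
      ... | yes _  = refl
      ... | no ¬Cz = contradiction ¬Cz ¬¬Cz

-- Arithmetic in the ordered group of weights.

module OrderedGroup (𝔾 : OrderedAbelianGroup) where
  open OrderedAbelianGroup 𝔾 renaming (_+_ to _⊕_; _≤_ to _≼_; ≤-trans to ≼-trans)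
  open import Algebra.Bundles using (AbelianGroup)
  import Relation.Binary.PropositionalEquality as ≡

  abelianGroup : AbelianGroup _ _
  abelianGroup = record
    { Carrier = Carrier ; _≈_ = _≡_ ; _∙_ = _⊕_ ; ε = 0# ; _⁻¹ = -_
    ; isAbelianGroup = record
      { isGroup = record
        { isMonoid = record
          { isSemigroup = record
            { isMagma = record { isEquivalence = ≡.isEquivalence ; ∙-cong = cong₂ _⊕_ }
            ; assoc = +-assoc }
          ; identity = +-identityˡ , λ x → trans (+-comm x 0#) (+-identityˡ x) }
        ; inverse = -‿inverseˡ , λ x → trans (+-comm x (- x)) (-‿inverseˡ x)
        ; ⁻¹-cong = cong -_ }
      ; comm = +-comm } }

  open AbelianGroup abelianGroup public using (commutativeMonoid; monoid)
  open import Algebra.Properties.AbelianGroup abelianGroup using (//-rightDividesʳ)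
  open import Algebra.Properties.CommutativeMonoid.Sum commutativeMonoid public
    using () renaming (sum to ⨁; ∑-distrib-+ to ⨁-distrib-⊕; sum-cong-≗ to ⨁-cong)

  ≼-cancel : ∀ {x y} z → x ⊕ z ≼ y ⊕ z → x ≼ y
  ≼-cancel {x} {y} z le = subst₂ _≼_ (//-rightDividesʳ z x) (//-rightDividesʳ z y) (+-monoˡ-≤ (- z) le)

  -- For exchanges, which preserve the total weight: if one result is no lighter than one of the two
  -- forests, the other result is no heavier than the other forest.
  ≼-squeeze : ∀ {a b a′ b′} → a′ ⊕ b′ ≡ a ⊕ b → b ≼ b′ → a′ ≼ a
  ≼-squeeze {a} {b} {a′} {b′} eq b≼b′ = ≼-cancel b′
    (subst₂ _≼_ (sym eq) refl (subst₂ _≼_ (+-comm b a) (+-comm b′ a) (+-monoˡ-≤ a b≼b′)))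

  ∑≡⨁ : ∀ {n} (f : Fin n → Carrier) → ∑ 𝔾 f ≡ ⨁ f
  ∑≡⨁ {zero}  f = refl
  ∑≡⨁ {suc n} f = cong (f Fin.zero ⊕_) (∑≡⨁ (f ∘ Fin.suc))

-- Forests of least total weight, and separating two vertices.

module Minimal (𝔾 : OrderedAbelianGroup) {N : ℕ} (arc : Fin N → Fin N → Bool)
               (c : Fin N → Maybe (Fin N) → OrderedAbelianGroup.Carrier 𝔾) where
  open OrderedAbelianGroup 𝔾 renaming (_+_ to _⊕_; _≤_ to _≼_; ≤-trans to ≼-trans)
  open OrderedGroup 𝔾

  -- Roots are priced as well, by `c z nothing`, so forests with different numbers of trees compete.
  W : Sub N → Carrier
  W G = ⨁ (λ z → c z (G z))

  W-mix : ∀ {U : Fin N → Set} (U? : Decidable U) A B →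
          W (mix U? A B) ⊕ W (mix U? B A) ≡ W A ⊕ W B
  W-mix U? A B = trans (sym (⨁-distrib-⊕ (λ z → c z (mix U? A B z)) (λ z → c z (mix U? B A z))))
    (trans (⨁-cong swap) (⨁-distrib-⊕ (λ z → c z (A z)) (λ z → c z (B z))))
    where
    swap : ∀ z → c z (mix U? A B z) ⊕ c z (mix U? B A z) ≡ c z (A z) ⊕ c z (B z)
    swap z with U? z
    ... | yes _ = refl
    ... | no _  = +-comm _ _

  VForest : Sub N → Set
  VForest G = InV arc G × Forest G

  mix-InV : ∀ {U : Fin N → Set} (U? : Decidable U) {A B} → InV arc A → InV arc B → InV arc (mix U? A B)
  mix-InV U? a b i j eq with U? i
  ... | yes _ = a i j eq
  ... | no _  = b i j eq

  IsMinimal : Sub N → Set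
  IsMinimal G = VForest G × (∀ G′ → VForest G′ → W G ≼ W G′)

  forest : ∀ {G} → IsMinimal G → Forest G
  forest = proj₂ ∘ proj₁

  -- The opposite exchange weighs at least as much as `B`, so this one weighs at most as much as
  -- `A`.
  mix-minimal : ∀ {U : Fin N → Set} (U? : Decidable U) {A B} → IsMinimal A → IsMinimal B →
                Forest (mix U? A B) → Forest (mix U? B A) → IsMinimal (mix U? A B)
  mix-minimal U? {A} {B} ((vA , fA) , minA) ((vB , fB) , minB) fAB fBA =
    (mix-InV U? vA vB , fAB) ,
    λ G′ g → ≼-trans (≼-squeeze (W-mix U? A B) (minB _ (mix-InV U? vB vA , fBA))) (minA G′ g)

  module Separation {H : Sub N} (mH : IsMinimal H) {r u u′ r′ : Fin N}
                    (Du : Root H u r) (Hu′ : Root H u′ r′) (r≢r′ : r ≢ r′) (v : Fin N) where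

    fH : Forest H
    fH = forest mH

    ¬Du′ : ¬ Root H u′ r
    ¬Du′ p = r≢r′ (root-unique p Hu′)

    Result : Set
    Result = ∃ λ G → IsMinimal G × (∀ z → H z ≡ nothing → G z ≡ nothing) × Sep G u v

    roots-kept : ∀ {G} → OffTree H r G → G r ≡ nothing → ∀ z → H z ≡ nothing → G z ≡ nothing
    roots-kept off Gr z Hz with root? fH z r
    ... | yes Dz with refl ← root-unique Dz (stop Hz) = Gr
    ... | no ¬Dz = trans (off ¬Dz) Hz

    AgreesWhere : Sub N → Sub N → Set
    AgreesWhere Q G = ∀ z → H z ≡ Q z → G z ≡ H z

    -- Beyond the last vertex `t` of the walk at which `H` and `Q` differ, every vertexwise mixture
    -- of the two follows `H` down to `r`.
    last-difference : ∀ Q {z} → Root H z r →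
      (∀ G → AgreesWhere Q G → Root G z r) ⊎
      (∃ λ t → H t ≢ Q t × (∀ G → AgreesWhere Q G → G t ≡ H t → Root G t r))
    last-difference Q {z} (stop e) with H z ≟ₘ Q z
    ... | yes eq = inj₁ λ G agree → stop (trans (agree z eq) e)
    ... | no ne  = inj₂ (z , ne , λ G _ Gz → stop (trans Gz e))
    last-difference Q {z} (step e p) with last-difference Q p
    ... | inj₂ t = inj₂ t
    ... | inj₁ tail with H z ≟ₘ Q z
    ...   | yes eq = inj₁ λ G agree → step (trans (agree z eq) e) (tail G agree)
    ...   | no ne  = inj₂ (z , ne , λ G agree Gz → step (trans Gz e) (tail G agree))

    module Step {F : Sub N} (mF : IsMinimal F) (Fu : F u ≡ just u′) (¬vu : ¬ Path F v u)
                (rec : ∀ {F′} → IsMinimal F′ → F′ u ≡ just u′ → ¬ Path F′ v u →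
                       dist F′ H < dist F H → Result) where

      module T = TreeExchange (forest mF) fH r

      Q : Sub N
      Q = T.F-on-H-off

      mQ : IsMinimal Q
      mQ = mix-minimal T.D? mF mH T.F-on-forest T.H-on-forest

      fQ : Forest Q
      fQ = forest mQ

      Qu : Q u ≡ just u′
      Qu = trans (T.F-on-in Du) Fu

      Q-root-u : Root Q u r′
      Q-root-u = step Qu (off-root T.F-on-off ¬Du′ Hu′)

      open BranchExchange fQ fH T.F-on-off Qu Du ¬Du′

      path-F : ∀ {z} → Path Q z u → Path F z u
      path-F here       = here
      path-F (step e p) = step (trans (sym (T.F-on-in (C⊆D (step e p)))) e) (path-F p)

      -- On `D`, which contains `C`, the arcs of `Q` are those of `F`.
      ¬Cv : ¬ C v
      ¬Cv = ¬vu ∘ path-F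

      -- Exchanging the r-tree of X between X and Q moves F closer to H, at least at t.
      continue : ∀ {X} → IsMinimal X → (∀ z → X z ≡ H z ⊎ X z ≡ Q z) → OffTree H r X →
                 ∀ {t} → H t ≢ Q t → X t ≡ H t → Root X t r → ¬ Root X u r → Result
      continue {X} mX between X-off {t} Ht≢Qt Xt Xtr ¬Xur = result
        where
        module X = TreeExchange fQ (forest mX) r
        G = X.H-on-F-off

        mG : IsMinimal G
        mG = mix-minimal X.D? mX mQ X.H-on-forest X.F-on-forest

        G-off : OffTree H r G
        G-off {z} ¬Dz with mix-either X.D? X Q z
        ... | inj₁ eq = trans eq (X-off ¬Dz)
        ... | inj₂ eq = trans eq (T.F-on-off ¬Dz)

        Gu : G u ≡ just u′
        Gu = trans (X.H-on-out ¬Xur) Qu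

        Gr : G r ≡ nothing
        Gr = root-nothing (X.H-on-root Xtr)

        -- The tree of `r` in `X` lies within that in `G`, so a walk outside the latter uses arcs of
        -- `Q` only.
        path-Q : ∀ {z} → ¬ Root G z r → Path G z u → Path Q z u
        path-Q ¬Gzr here       = here
        path-Q ¬Gzr (step e p) =
          step (trans (sym (X.H-on-out (¬Gzr ∘ X.H-on-root))) e) (path-Q (¬Gzr ∘ step e) p)

        G-between : ∀ z → G z ≡ H z ⊎ G z ≡ F z
        G-between z with X.D? z
        ... | no _ = Q-between z
          where
          Q-between : ∀ z → Q z ≡ H z ⊎ Q z ≡ F z
          Q-between z with mix-either T.D? F H z
          ... | inj₁ eq = inj₂ eq
          ... | inj₂ eq = inj₁ eq
        ... | yes _ with between z
        ...   | inj₁ eq = inj₁ eq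
        ...   | inj₂ eq with mix-either T.D? F H z
        ...     | inj₁ eq′ = inj₂ (trans eq eq′)
        ...     | inj₂ eq′ = inj₁ (trans eq eq′)

        Ft≢Ht : F t ≢ H t
        Ft≢Ht Ft with mix-either T.D? F H t
        ... | inj₁ eq = Ht≢Qt (sym (trans eq Ft))
        ... | inj₂ eq = Ht≢Qt (sym eq)

        result : Result
        result with root? (forest mG) v r
        -- `G` sends `u` through `u′` to `r′`, away from its tree of `r`.
        ... | yes Gvr = G , mG , roots-kept G-off Gr ,
          r′ , r , step Gu (off-root G-off ¬Du′ Hu′) , Gvr , r≢r′ ∘ sym
        ... | no ¬Gvr = rec mG Gu (¬Cv ∘ path-Q ¬Gvr)
          (dist-< G-between t (trans (X.H-on-in Xtr) Xt) Ft≢Ht)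

      result : Result
      result with last-difference Q Du
      -- Without a difference `Q` would lead `u` to `r`, but it leads `u` through `u′` to `r′`.
      ... | inj₁ agree = contradiction
        (root-unique (agree Q λ _ → sym) Q-root-u) r≢r′
      ... | inj₂ (t , Ht≢Qt , tail) with C? t
      -- `X` keeps the arc of `H` at `t`, so `t` stays in the tree of `r`, while `u` goes to `exit`,
      -- which is `r′`.
      ...   | no ¬Ct = case root? {G = X} (forest mX) v r of λ where
              (yes Xvr) → X , mX , roots-kept Q-on-off (root-nothing Xtr) ,
                _ , r , Xu , Xvr , exit≢r
              (no ¬Xvr) → continue mX between Q-on-off Ht≢Qt (Q-on-out ¬Ct) Xtr
                (exit≢r ∘ root-unique Xu)
        where
        X = Q-on-H-off

        mX : IsMinimal X
        mX = mix-minimal C? mQ mH Q-on-forest H-on-forest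

        between : ∀ z → X z ≡ H z ⊎ X z ≡ Q z
        between z = [ inj₂ , inj₁ ]′ (mix-either C? Q H z)

        Xtr : Root X t r
        Xtr = tail X (λ z eq → [ (λ e → trans e (sym eq)) , id ]′ (mix-either C? Q H z))
                   (Q-on-out ¬Ct)

        Xu : Root X u exit
        Xu = Q-on-root here

        exit≢r : exit ≢ r
        exit≢r eq = r≢r′ (trans (sym eq) (root-unique exit-root Hu′))
      -- Now `H` is used on `C`, so again `X t` is `H t`. Since `v` lies outside `C`, its root in
      -- `X` is its root in `Q`; if that is `r`, then `Q` itself separates.
      ...   | yes Ct = case (root? (forest mX) v r ,′ root? (forest mX) u r) of λ where
              (yes Xvr , _) → let Qvr = Q-root-v Xvr in
                Q , mQ , roots-kept T.F-on-off (root-nothing Qvr) , r′ , r , Q-root-u , Qvr , r≢r′ ∘ sym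
              (no ¬Xvr , yes Xur) → X , mX , roots-kept H-on-off (root-nothing Xtr) ,
                r , proj₁ (forest mX v) , Xur , proj₂ (forest mX v) ,
                λ eq → ¬Xvr (subst (Root X v) (sym eq) (proj₂ (forest mX v)))
              (no _ , no ¬Xur) → continue mX (mix-either C? H Q) H-on-off Ht≢Qt (H-on-in Ct) Xtr ¬Xur
        where
        X = H-on-Q-off

        mX : IsMinimal X
        mX = mix-minimal C? mH mQ H-on-forest Q-on-forest

        Xtr : Root X t r
        Xtr = tail X (λ z eq → [ id , (λ e → trans e (sym eq)) ]′ (mix-either C? H Q z))
                   (H-on-in Ct)

        Q-root-v : Root X v r → Root Q v r
        Q-root-v Xvr = subst (Root Q v) (root-unique (H-off-root ¬Cv (proj₂ (fQ v))) Xvr) (proj₂ (fQ v))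

    separate : ∀ {F} → IsMinimal F → F u ≡ just u′ → ¬ Path F v u → Result
    separate {F} = go F (<-wellFounded (dist F H))
      where
      go : ∀ F → Acc _<_ (dist F H) → IsMinimal F → F u ≡ just u′ → ¬ Path F v u → Result
      go F (acc rs) mF Fu ¬vu = Step.result mF Fu ¬vu (λ {F′} mF′ Fu′ ¬vu′ lt → go F′ (rs lt) mF′ Fu′ ¬vu′)

-- Removing one tree while two vertices stay separated.

module Dropping (𝔾 : OrderedAbelianGroup) {N : ℕ} (arc : Fin N → Fin N → Bool)
                (c : Fin N → Maybe (Fin N) → OrderedAbelianGroup.Carrier 𝔾)
                {A : Sub N} (mA : Minimal.IsMinimal 𝔾 arc c A) where
  open Minimal 𝔾 arc c

  Dropped : ℕ → Fin N → Fin N → Set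
  Dropped n u v = ∃ λ B → IsMinimal B × suc (numTrees B) ≡ n × Sep B u v

  -- The tree of `r` dissolves along the arcs of `A`; outside it, where `u` and `v` lie, roots do
  -- not change.
  drop-tree : ∀ {B r} → IsMinimal B → Free A B r →
              ∀ {u v} → ¬ Root B u r → ¬ Root B v r → Sep B u v → Dropped (numTrees B) u v
  drop-tree {B} {r} mB free ¬ur ¬vr (s , t , us , vt , s≢t) =
    F-on-H-off , mix-minimal D? mA mB F-on-forest H-on-forest , numTrees-F-on free ,
    s , t , off-root F-on-off ¬ur us , off-root F-on-off ¬vr vt , s≢t
    where open TreeExchange (forest mA) (forest mB) r

  leave : ∀ {W : Fin N → Set} → Decidable W → (∀ z → W z → A z ≢ nothing) →
          ∀ {z s} → Root A z s → W z → ∃₂ λ x x′ → W x × A x ≡ just x′ × ¬ W x′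
  leave W? inner (stop e) Wz = contradiction e (inner _ Wz)
  leave W? inner (step {z′ = z′} e p) Wz with W? z′
  ... | yes Wz′ = leave W? inner p Wz′
  ... | no ¬Wz′ = _ , z′ , Wz , e , ¬Wz′

  -- Once the tree of `r` is dissolved there are still more trees than in `A`, hence a free one, and
  -- it contains the tree of `B` with the same root.
  second-free : ∀ {B r} → IsMinimal B → Free A B r → suc (suc (numTrees A)) ≤ numTrees B →
                ∃ λ s → s ≢ r × Free A B s
  second-free {B} {r} mB free le = s , s≢r , trans (sym (F-on-off ¬sr)) (proj₁ free-s) ,
    λ z zs → proj₂ free-s z (off-root F-on-off (s≢r ∘ root-unique zs) zs)
    where
    open TreeExchange (forest mA) (forest mB) r
    another = free-tree {A = A} F-on-forest (≤-pred (subst (_ ≤_) (sym (numTrees-F-on free)) le))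
    s = proj₁ another
    free-s = proj₂ another
    ¬sr : ¬ Root B s r
    ¬sr sr = proj₂ free s sr (trans (sym (F-on-in sr)) (proj₁ free-s))
    s≢r : s ≢ r
    s≢r eq = ¬sr (subst (λ q → Root B q r) (sym eq) (stop (proj₁ free)))

  module _ {B : Sub N} (mB : IsMinimal B) {u v r s : Fin N}
           (ur : Root B u r) (vs : Root B v s) (r≢s : r ≢ s) where

    drop-other : ∀ {q} → Free A B q → q ≢ r → q ≢ s → Dropped (numTrees B) u v
    drop-other free q≢r q≢s = drop-tree mB free
      (λ uq → q≢r (root-unique uq ur)) (λ vq → q≢s (root-unique vq vs)) (r , s , ur , vs , r≢s)

    both-free : suc (suc (numTrees A)) ≤ numTrees B → Dropped (numTrees B) u v ⊎ Free A B r × Free A B s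
    both-free le with p , fp ← free-tree {A = A} (forest mB) (≤-trans (ℕ.s≤s (ℕₚ.n≤1+n _)) le)
      with q , q≢p , fq ← second-free mB fp le | p ≟ r | p ≟ s
    ... | no p≢r | no p≢s = inj₁ (drop-other fp p≢r p≢s)
    ... | yes refl | _ with q ≟ s
    ...   | yes refl = inj₂ (fp , fq)
    ...   | no q≢s   = inj₁ (drop-other fq q≢p q≢s)
    both-free le | no _ | yes refl with q ≟ r
    ...   | yes refl = inj₂ (fq , fp)
    ...   | no q≢r   = inj₁ (drop-other fq q≢r q≢p)

    -- C leaves the tree of r for a third tree: if r lies in C that tree dissolves,
    -- otherwise it either still contains u or can be dropped.
    branch-out : Free A B r → ∀ {x x′} → Root B x r → A x ≡ just x′ → ¬ Root B x′ r → ¬ Root B x′ s →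
                 (∀ {X} → IsMinimal X → numTrees X ≡ numTrees B → Root X u r → Root X v s →
                   dist X A < dist B A → Dropped (numTrees X) u v) →
                 Dropped (numTrees B) u v
    branch-out free {x} {x′} xr Ax ¬x′r ¬x′s rec = result
      where
      module T = TreeExchange (forest mA) (forest mB) r

      mQ : IsMinimal T.F-on-H-off
      mQ = mix-minimal T.D? mA mB T.F-on-forest T.H-on-forest

      open BranchExchange (forest mQ) (forest mB) T.F-on-off (trans (T.F-on-in xr) Ax) xr ¬x′r

      X = Q-on-H-off

      mX : IsMinimal X
      mX = mix-minimal C? mQ mB Q-on-forest H-on-forest

      X≡A : ∀ {z} → C z → X z ≡ A z
      X≡A Cz = trans (Q-on-in Cz) (T.F-on-in (C⊆D Cz))

      X-nothing : ∀ z → X z ≡ nothing → ¬ C z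
      X-nothing z Xz Cz = proj₂ free z (C⊆D Cz) (trans (sym (X≡A Cz)) Xz)

      Xv : Root X v s
      Xv = off-root Q-on-off (λ vr → r≢s (root-unique vr vs)) vs

      ¬vr : ¬ Root X v r
      ¬vr vr = r≢s (root-unique vr Xv)

      exit≢r : exit ≢ r
      exit≢r eq = ¬x′r (subst (Root B x′) eq exit-root)

      exit≢s : exit ≢ s
      exit≢s eq = ¬x′s (subst (Root B x′) eq exit-root)

      -- The walk of `B` to `r` is diverted to `exit` where it meets `C`, and otherwise survives.
      X-root : ∀ {z} → Root B z r → Root X z exit ⊎ (¬ C r × Root X z r)
      X-root {z} zr with C? z
      ... | yes Cz = inj₁ (Q-on-root Cz)
      X-root (stop e) | no ¬Cr = inj₂ (¬Cr , stop (trans (Q-on-out ¬Cr) e))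
      X-root (step e p) | no ¬Cz with X-root p
      ... | inj₁ q         = inj₁ (step (trans (Q-on-out ¬Cz) e) q)
      ... | inj₂ (¬Cr , q) = inj₂ (¬Cr , step (trans (Q-on-out ¬Cz) e) q)

      Br = proj₁ free

      result : Dropped (numTrees B) u v
      result with C? r | X-root ur
      ... | yes Cr | inj₂ (¬Cr , _) = contradiction Cr ¬Cr
      -- Only `r` ceases to be a root, so `X` already has one tree fewer.
      ... | yes Cr | inj₁ Xu = X , mX ,
        numTrees-suc X B r (λ Xr → X-nothing r Xr Cr) Br
          (λ z _ Xz → trans (sym (Q-on-out (X-nothing z Xz))) Xz)
          (λ z z≢r Bz → trans (Q-on-out (λ Cz → z≢r (root-unique (stop Bz) (C⊆D Cz)))) Bz) ,
        exit , s , Xu , Xv , exit≢s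
      ... | no ¬Cr | Xu-cases = subst (λ n → Dropped n u v) same (continue Xu-cases)
        where
        same : numTrees X ≡ numTrees B
        same = ℕₚ.≤-antisym
          (numTrees-mono X B λ z Xz → trans (sym (Q-on-out (X-nothing z Xz))) Xz)
          (numTrees-mono B X λ z Bz → trans (Q-on-out (λ Cz →
            ¬Cr (subst C (root-unique (stop Bz) (C⊆D Cz)) Cz))) Bz)

        Xr : X r ≡ nothing
        Xr = trans (Q-on-out ¬Cr) Br

        -- Vertices outside the old tree of `r` keep their roots, so the new tree lies within the
        -- old one.
        free-X : Free A X r
        free-X = Xr , λ z zr → case T.D? z of λ where
          (yes Dz) → proj₂ free z Dz
          (no ¬Dz) → contradiction
            (subst (Root B z) (root-unique (off-root Q-on-off ¬Dz (proj₂ (forest mB z))) zr) (proj₂ (forest mB z)))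
            ¬Dz

        -- The arc of `A` at `x` leaves the tree of `r` in `B`, so `B` does not have it; `X` does.
        closer : dist X A < dist B A
        closer = dist-< between x (X≡A here) λ eq →
          ¬x′r (root-next (trans eq Ax) xr)
          where
          between : ∀ z → X z ≡ A z ⊎ X z ≡ B z
          between z = case C? z of λ where
            (yes Cz) → inj₁ (X≡A Cz)
            (no ¬Cz) → inj₂ (Q-on-out ¬Cz)

        continue : Root X u exit ⊎ (¬ C r × Root X u r) → Dropped (numTrees X) u v
        continue (inj₂ (_ , Xur)) = rec mX same Xur Xv closer
        continue (inj₁ Xu) = drop-tree mX free-X (exit≢r ∘ root-unique Xu) ¬vr
          (exit , s , Xu , Xv , exit≢s)

  -- When `both-free` drops nothing, the trees of `u` and `v` contain no root of `A`. So some arc of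
  -- `A` leaves their union, and `branch-out` applies to the tree in which it starts.
  drop : ∀ {B} → IsMinimal B → suc (suc (numTrees A)) ≤ numTrees B →
         ∀ {u v} → Sep B u v → Dropped (numTrees B) u v
  drop {B} mB le (r , s , ur , vs , r≢s) = go B (<-wellFounded (dist B A)) mB le ur vs r≢s
    where
    go : ∀ B → Acc _<_ (dist B A) → IsMinimal B → suc (suc (numTrees A)) ≤ numTrees B →
         ∀ {u v r s} → Root B u r → Root B v s → r ≢ s → Dropped (numTrees B) u v
    go B (acc rs) mB le {u} {v} {r} {s} ur vs r≢s =
      [ id , (λ (free-r , free-s) → out free-r free-s) ]′ (both-free mB ur vs r≢s le)
      where
      Either : Fin N → Set
      Either z = Root B z r ⊎ Root B z s

      flip : ∀ {n u v} → Dropped n u v → Dropped n v u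
      flip (B , mB , eq , sep) = B , mB , eq , sep-sym sep

      rec : ∀ {X} → IsMinimal X → numTrees X ≡ numTrees B → Root X u r → Root X v s →
            dist X A < dist B A → Dropped (numTrees X) u v
      rec {X} mX same Xur Xvs lt = go X (rs lt) mX
        (subst (suc (suc (numTrees A)) ≤_) (sym same) le) Xur Xvs r≢s

      branch : Free A B r → Free A B s → (∃₂ λ x x′ → Either x × A x ≡ just x′ × ¬ Either x′) →
               Dropped (numTrees B) u v
      branch free-r free-s (x , x′ , inj₁ xr , Ax , ¬either) =
        branch-out mB ur vs r≢s free-r xr Ax (¬either ∘ inj₁) (¬either ∘ inj₂) rec
      branch free-r free-s (x , x′ , inj₂ xs , Ax , ¬either) =
        flip (branch-out mB vs ur (r≢s ∘ sym) free-s xs Ax (¬either ∘ inj₂) (¬either ∘ inj₁)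
          (λ mX same Xvs Xur lt → flip (rec mX same Xur Xvs lt)))

      out : Free A B r → Free A B s → Dropped (numTrees B) u v
      out free-r free-s = branch free-r free-s
        (leave (λ z → root? (forest mB) z r ⊎-dec root? (forest mB) z s)
               (λ z → [ proj₂ free-r z , proj₂ free-s z ]′)
               (proj₂ (forest mA r)) (inj₁ (stop (proj₁ free-r))))

-- The root weight as a Lagrange multiplier.

module Lagrange (𝔾 : OrderedAbelianGroup) {N : ℕ} (arc : Fin N → Fin N → Bool)
                (v : Fin N → Fin N → OrderedAbelianGroup.Carrier 𝔾) {k : ℕ} {F H : Sub N}
                (optF : Problem.Optimal 𝔾 arc v k F) (optH : Problem.Optimal 𝔾 arc v (suc k) H) where
  open OrderedAbelianGroup 𝔾 renaming (_+_ to _⊕_; _≤_ to _≼_; ≤-trans to ≼-trans)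
  open OrderedGroup 𝔾
  open Problem 𝔾 arc v
  open import Algebra.Properties.Monoid.Mult monoid using (×-homo-+) renaming (_×_ to _·_)

  -- The value at which `F` and `H`, with `k` and `suc k` trees, get equal total weight.
  rootCost : Carrier
  rootCost = Υ F ⊕ - Υ H

  open Minimal 𝔾 arc (λ i → maybe (v i) rootCost)

  ⨁-· : ∀ {n} (f : Fin n → ℕ) x → ⨁ (λ i → f i · x) ≡ sum f · x
  ⨁-· {zero}  f x = refl
  ⨁-· {suc n} f x = trans (cong (f Fin.zero · x ⊕_) (⨁-· (f ∘ Fin.suc) x))
    (sym (×-homo-+ x (f Fin.zero) _))

  W≡Υ : ∀ G → W G ≡ Υ G ⊕ numTrees G · rootCost
  W≡Υ G = begin
    W G                                                     ≡⟨ ⨁-cong term ⟩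
    ⨁ (λ i → arcCost i ⊕ isRoot (G i) · rootCost)           ≡⟨ ⨁-distrib-⊕ arcCost (λ i → isRoot (G i) · rootCost) ⟩
    ⨁ arcCost ⊕ ⨁ (λ i → isRoot (G i) · rootCost)           ≡⟨ cong₂ _⊕_ (sym (∑≡⨁ arcCost)) (⨁-· (isRoot ∘ G) rootCost) ⟩
    Υ G ⊕ sum (isRoot ∘ G) · rootCost                       ≡⟨ cong (λ n → Υ G ⊕ n · rootCost) (numTrees≡sum G) ⟨
    Υ G ⊕ numTrees G · rootCost                             ∎
    where
    open ≡-Reasoning
    arcCost : Fin N → Carrier
    arcCost i = maybe (v i) 0# (G i)
    x⊕0 : ∀ x → x ⊕ 0# ≡ x
    x⊕0 x = trans (+-comm x 0#) (+-identityˡ x)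
    term : ∀ i → maybe (v i) rootCost (G i) ≡ arcCost i ⊕ isRoot (G i) · rootCost
    term i with G i
    ... | just j  = sym (x⊕0 _)
    ... | nothing = trans (sym (x⊕0 _)) (sym (+-identityˡ _))

  W-mono : ∀ {n} G G′ → numTrees G ≡ n → numTrees G′ ≡ n → Υ G ≼ Υ G′ → W G ≼ W G′
  W-mono G G′ refl eq le rewrite W≡Υ G | W≡Υ G′ | eq = +-monoˡ-≤ _ le

  W-mono⁻ : ∀ {n} G G′ → numTrees G ≡ n → numTrees G′ ≡ n → W G ≼ W G′ → Υ G ≼ Υ G′
  W-mono⁻ G G′ refl eq le rewrite W≡Υ G | W≡Υ G′ | eq = ≼-cancel _ le

  W-F≡W-H : W F ≡ W H
  W-F≡W-H = begin
    W F                                    ≡⟨ W≡Υ F ⟩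
    Υ F ⊕ numTrees F · rootCost            ≡⟨ cong (λ n → Υ F ⊕ n · rootCost) (proj₂ (proj₁ optF)) ⟩
    Υ F ⊕ k · rootCost                     ≡⟨ cong (_⊕ k · rootCost) shift ⟨
    (Υ H ⊕ rootCost) ⊕ k · rootCost        ≡⟨ +-assoc _ _ _ ⟩
    Υ H ⊕ suc k · rootCost                 ≡⟨ cong (λ n → Υ H ⊕ n · rootCost) (proj₂ (proj₁ optH)) ⟨
    Υ H ⊕ numTrees H · rootCost            ≡⟨ W≡Υ H ⟨
    W H                                    ∎
    where
    open ≡-Reasoning
    shift : Υ H ⊕ (Υ F ⊕ - Υ H) ≡ Υ F
    shift = trans (+-comm _ _) (trans (+-assoc _ _ _)
      (trans (cong (Υ F ⊕_) (-‿inverseˡ (Υ H))) (trans (+-comm _ 0#) (+-identityˡ _))))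

  vforest : ∀ {n G} → InForests n G → VForest G
  vforest ((inV , acyclic) , _) = inV , acyclic⇒forest {arc = arc} acyclic

  inForests : ∀ {n G} → VForest G → numTrees G ≡ n → InForests n G
  inForests (inV , f) eq = (inV , forest⇒acyclic {arc = arc} f) , eq

  vF = vforest (proj₁ optF)
  vH = vforest (proj₁ optH)

  W-F-least : ∀ {G} → VForest G → numTrees G ≡ k → W F ≼ W G
  W-F-least {G} vG eq = W-mono F G (proj₂ (proj₁ optF)) eq (proj₂ optF _ (inForests vG eq))

  W-H-least : ∀ {G} → VForest G → numTrees G ≡ suc k → W F ≼ W G
  W-H-least {G} vG eq = subst (_≼ W G) (sym W-F≡W-H)
    (W-mono H G (proj₂ (proj₁ optH)) eq (proj₂ optH _ (inForests vG eq)))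

  -- Exchanging a free tree of `H` with `G` yields a forest with `k` trees, no lighter than `F`, and
  -- one with a tree more than `G`, hence no heavier than `G`. The latter is closer to `k` trees.
  W-least-below : ∀ d G → VForest G → numTrees G ℕ.+ d ≡ k → W F ≼ W G
  W-least-below zero    G vG eq = W-F-least vG (trans (sym (+-identityʳ _)) eq)
  W-least-below (suc d) G vG eq = ≼-trans
    (W-least-below d H-on-F-off (mix-InV D? (proj₁ vH) (proj₁ vG) , H-on-forest)
      (trans (cong (ℕ._+ d) (numTrees-H-on free)) (trans (sym (+-suc _ d)) eq)))
    (≼-squeeze (trans (W-mix D? H G) (+-comm _ _))
      (subst (_≼ W F-on-H-off) W-F≡W-H (W-F-least (mix-InV D? (proj₁ vG) (proj₁ vH) , F-on-forest)
        (suc-injective (trans (numTrees-F-on free) (proj₂ (proj₁ optH)))))))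
    where
    G<H : numTrees G < numTrees H
    G<H = subst (numTrees G <_) (trans (cong suc eq) (sym (proj₂ (proj₁ optH)))) (s≤s (m≤m+n _ (suc d)))
    free = proj₂ (free-tree {A = G} {B = H} (proj₂ vH) G<H)
    open TreeExchange (proj₂ vG) (proj₂ vH) (proj₁ (free-tree {A = G} {B = H} (proj₂ vH) G<H))

  -- The mirror image: a free tree of `G` goes to `F`, which then has `suc k` trees and is no
  -- lighter than `H`.
  W-least-above : ∀ d G → VForest G → suc k ℕ.+ d ≡ numTrees G → W F ≼ W G
  W-least-above zero    G vG eq = W-H-least vG (trans (sym eq) (+-identityʳ _))
  W-least-above (suc d) G vG eq = ≼-trans
    (W-least-above d F-on-H-off (mix-InV D? (proj₁ vF) (proj₁ vG) , F-on-forest)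
      (suc-injective (trans (sym (+-suc (suc k) d)) (trans eq (sym (numTrees-F-on free))))))
    (≼-squeeze (trans (W-mix D? F G) (+-comm _ _))
      (W-H-least (mix-InV D? (proj₁ vG) (proj₁ vF) , H-on-forest)
        (trans (numTrees-H-on free) (cong suc (proj₂ (proj₁ optF))))))
    where
    F<G : numTrees F < numTrees G
    F<G rewrite proj₂ (proj₁ optF) = subst (suc k ≤_) eq (m≤m+n _ _)
    free = proj₂ (free-tree {A = F} {B = G} (proj₂ vG) F<G)
    open TreeExchange (proj₂ vF) (proj₂ vG) (proj₁ (free-tree {A = F} {B = G} (proj₂ vG) F<G))

  W-least : ∀ G → VForest G → W F ≼ W G
  W-least G vG with ≤-<-connex (numTrees G) k
  ... | inj₁ le with d , eq ← m≤n⇒∃[o]m+o≡n le = W-least-below d G vG eq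
  ... | inj₂ lt with d , eq ← m≤n⇒∃[o]m+o≡n lt = W-least-above d G vG eq

  F-minimal : IsMinimal F
  F-minimal = vF , W-least

  optimal⇒minimal : ∀ {G} → Optimal (suc k) G → IsMinimal G
  optimal⇒minimal {G} (g , least) = vforest g , λ G′ vG′ → ≼-trans
    (subst (W G ≼_) (sym W-F≡W-H) (W-mono G H (proj₂ g) (proj₂ (proj₁ optH)) (least H (proj₁ optH))))
    (W-least G′ vG′)

  minimal⇒optimal : ∀ {G} → IsMinimal G → numTrees G ≡ suc k → Optimal (suc k) G
  minimal⇒optimal {G} (vG , least) eq = inForests vG eq ,
    λ G′ g′ → W-mono⁻ G G′ eq (proj₂ g′) (least G′ (vforest g′))

-- Atoms and separation by optimal forests.

module Atoms (𝔾 : OrderedAbelianGroup) {N : ℕ} (arc : Fin N → Fin N → Bool)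
             (v : Fin N → Fin N → OrderedAbelianGroup.Carrier 𝔾) {k : ℕ} where
  open Problem 𝔾 arc v

  optimal-forest : ∀ {G} → Optimal k G → Forest G
  optimal-forest (((_ , acyclic) , _) , _) = acyclic⇒forest {arc = arc} acyclic

  -- Every member of the algebra is built from some generator, which carries an optimal forest.
  some-optimal : ∀ {P} → InAlg k P → ∃ (Optimal k)
  some-optimal (gen F r opt _) = F , opt
  some-optimal (compl a)       = some-optimal a
  some-optimal (inter a _)     = some-optimal a
  some-optimal (ext a _)       = some-optimal a

  -- Needed so that a walk can test whether it is still inside an atom.
  algebra-decidable : ∀ {P} → InAlg k P → Decidable P
  algebra-decidable (gen F r opt Fr) i =
    map′ root⇒inTree (inTree⇒root Fr) (root? (optimal-forest opt) i r)
  algebra-decidable (compl a) i   = ¬? (algebra-decidable a i)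
  algebra-decidable (inter a b) i = algebra-decidable a i ×-dec algebra-decidable b i
  algebra-decidable (ext a P⇔Q) i =
    map′ (Equivalence.to (P⇔Q i)) (Equivalence.from (P⇔Q i)) (algebra-decidable a i)

  Together : Fin N → Fin N → Set
  Together i j = ∀ G → Optimal k G → ¬ Sep G i j

  together-root : ∀ {i j} → Together i j → ∀ {G r} → Optimal k G → Root G i r → Root G j r
  together-root {i} {j} tog {G} {r} opt p with optimal-forest opt j
  ... | s , q with r ≟ s
  ...   | yes refl = q
  ...   | no r≢s   = contradiction (r , s , p , q , r≢s) (tog G opt)

  together-sym : ∀ {i j} → Together i j → Together j i
  together-sym tog G opt sep = tog G opt (sep-sym sep)

  algebra-respects : ∀ {P} → InAlg k P → ∀ {i j} → Together i j → P i → P j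
  algebra-respects (gen F r opt Fr) tog p = root⇒inTree (together-root tog opt (inTree⇒root Fr p))
  algebra-respects (compl a) tog ¬p q      = ¬p (algebra-respects a (together-sym tog) q)
  algebra-respects (inter a b) tog (p , q) = algebra-respects a tog p , algebra-respects b tog q
  algebra-respects (ext a P⇔Q) {i} {j} tog q =
    Equivalence.to (P⇔Q j) (algebra-respects a tog (Equivalence.from (P⇔Q i) q))

  -- The tree of `G` that contains `i` meets `E`, so by atomicity it contains `E`.
  atom-together : ∀ {E} → IsAtom k E → ∀ {i j} → E i → E j → Together i j
  atom-together (_ , _ , atomic) {i} {j} Ei Ej G opt (r , s , p , q , r≢s)
    with atomic _ (gen G r opt (root-nothing p))
  ... | inj₁ disjoint = disjoint i (Ei , root⇒inTree p)
  ... | inj₂ E⊆       = r≢s (root-unique (inTree⇒root (root-nothing p) (E⊆ j Ej)) q)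

-- Uniqueness of the exit from an atom.

module Main (𝔾 : OrderedAbelianGroup) {N : ℕ} (arc : Fin N → Fin N → Bool)
            (v : Fin N → Fin N → OrderedAbelianGroup.Carrier 𝔾) {k : ℕ} {F : Sub N}
            (optF : Problem.Optimal 𝔾 arc v k F) {E : Fin N → Set}
            (atom : Problem.IsAtom 𝔾 arc v (suc k) E) where
  open Problem 𝔾 arc v
  open Atoms 𝔾 arc v {suc k}

  E-alg : InAlg (suc k) E
  E-alg = proj₁ atom

  H : Sub N
  H = proj₁ (some-optimal E-alg)

  optH : Optimal (suc k) H
  optH = proj₂ (some-optimal E-alg)

  open Lagrange 𝔾 arc v optF optH
  open Minimal 𝔾 arc (λ i → maybe (v i) rootCost)
  open Dropping 𝔾 arc (λ i → maybe (v i) rootCost) F-minimal using (drop)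

  numTrees-F : numTrees F ≡ k
  numTrees-F = proj₂ (proj₁ optF)

  -- `drop` removes surplus trees one by one; at `suc k` trees the forest is optimal and may not
  -- separate two vertices of an atom.
  not-separated : ∀ {x y G} → E x → E y → IsMinimal G → suc k ≤ numTrees G → ¬ Sep G x y
  not-separated {x} {y} Ex Ey mG k<G with d , eq ← m≤n⇒∃[o]m+o≡n k<G = go d mG eq
    where
    enough : ∀ {d n} → suc k ℕ.+ suc d ≡ n → suc (suc (numTrees F)) ≤ n
    enough {d} eq rewrite numTrees-F = subst (suc (suc k) ≤_) (trans (sym (+-suc (suc k) d)) eq) (m≤m+n _ d)

    go : ∀ d {G} → IsMinimal G → suc k ℕ.+ d ≡ numTrees G → ¬ Sep G x y
    go zero mG eq = atom-together atom Ex Ey _ (minimal⇒optimal mG (trans (sym eq) (+-identityʳ _)))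
    go (suc d) mG eq sep =
      let G′ , mG′ , eq′ , sep′ = drop mG (enough eq) sep
      in go d mG′ (suc-injective (trans (sym (+-suc (suc k) d)) (trans eq (sym eq′)))) sep′

  -- Vacuous at a root, so roots of `F` in `E` count as exits.
  LastIn : Fin N → Set
  LastIn x = ∀ {x′} → F x ≡ just x′ → ¬ E x′

  fF : Forest F
  fF = forest F-minimal

  -- Otherwise `separate` would turn an optimal forest separating `x` from `x′` into a minimal one,
  -- with no fewer trees, separating `x` from `y`. Hence no optimal forest separates `x` from `x′`,
  -- and `x′` would lie in `E`.
  exit-dominates : ∀ {x y x′} → E x → E y → F x ≡ just x′ → ¬ E x′ → ¬ ¬ Path F y x
  exit-dominates {x} {y} {x′} Ex Ey Fx ¬Ex′ ¬yx = ¬Ex′ (algebra-respects E-alg together Ex)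
    where
    together : Together x x′
    together K optK (r , r′ , xr , x′r′ , r≢r′)
      with G , mG , roots , sep ←
        Separation.separate (optimal⇒minimal optK) xr x′r′ r≢r′ y F-minimal Fx ¬yx
      = not-separated Ex Ey mG (subst (_≤ numTrees G) (proj₂ (proj₁ optK)) (numTrees-mono K G roots)) sep

  -- A free tree of `H` contains no root of `F`; exchanging it keeps `x` and `y` as roots and yields
  -- `suc k` trees.
  one-root : ∀ {x y} → E x → E y → F x ≡ nothing → F y ≡ nothing → x ≡ y
  one-root {x} {y} Ex Ey Fx Fy with x ≟ y
  ... | yes eq = eq
  ... | no x≢y with r , free ← free-tree {A = F} {B = H} (proj₂ vH)
                      (≤-reflexive (trans (cong suc numTrees-F) (sym (proj₂ (proj₁ optH)))))
    = ⊥-elim (not-separated Ex Ey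
        (mix-minimal D? (optimal⇒minimal optH) F-minimal H-on-forest F-on-forest)
        (≤-reflexive (sym (trans (numTrees-H-on free) (cong suc numTrees-F))))
        (x , y , stop (kept Fx) , stop (kept Fy) , x≢y))
    where
    open TreeExchange fF (proj₂ vH) r
    kept : ∀ {z} → F z ≡ nothing → H-on-F-off z ≡ nothing
    kept {z} Fz = trans (H-on-out λ Dz → proj₂ free z Dz Fz) Fz

  -- A root leads to no other vertex, and two exits that lead to each other coincide by acyclicity.
  exit-unique : ∀ {x y} → E x → E y → LastIn x → LastIn y → x ≡ y
  exit-unique {x} {y} Ex Ey lx ly with F x in Fx | F y in Fy
  ... | nothing | nothing = one-root Ex Ey Fx Fy
  ... | just x′ | nothing = ⊥-elim (exit-dominates Ex Ey Fx (lx refl) λ where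
      here         → just≢nothing {G = F} Fx Fy
      (step e _) → just≢nothing {G = F} e Fy)
  ... | nothing | just y′ = ⊥-elim (exit-dominates Ey Ex Fy (ly refl) λ where
      here         → just≢nothing {G = F} Fy Fx
      (step e _) → just≢nothing {G = F} e Fx)
  ... | just x′ | just y′ with x ≟ y
  ...   | yes eq = eq
  ...   | no x≢y = ⊥-elim (exit-dominates Ex Ey Fx (lx refl) λ yx →
      exit-dominates Ey Ex Fy (ly refl) λ xy → x≢y (path-antisym (proj₂ (fF x)) xy yx))

  exit-from : ∀ {i r} → E i → Root F i r → ∃ λ x → E x × LastIn x × EqClosure (InducedArc F E) i x
  exit-from Ei (stop e) = _ , Ei , (λ e′ _ → just≢nothing {G = F} e′ e) , ε
  exit-from {i} Ei (step {z′ = j} e p) with algebra-decidable E-alg j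
  ... | no ¬Ej = i , Ei , (λ e′ Ex′ → ¬Ej (subst E (just-unique {G = F} e′ e) Ex′)) , ε
  ... | yes Ej with x , Ex , lx , path ← exit-from Ej p =
    x , Ex , lx , transitive _ (return (Ei , Ej , e)) path

  inducedIsTree : InducedIsTree F E
  inducedIsTree = proj₁ (proj₂ atom) , connected
    where
    connected : ∀ i j → E i → E j → EqClosure (InducedArc F E) i j
    connected i j Ei Ej
      with x , Ex , lx , i⟶x ← exit-from Ei (proj₂ (fF i))
         | y , Ey , ly , j⟶y ← exit-from Ej (proj₂ (fF j))
      with refl ← exit-unique Ex Ey lx ly = transitive _ i⟶x (symmetric _ j⟶y)

theorem6 : (G : OrderedAbelianGroup) (N : ℕ)
    (arc : Fin N → Fin N → Bool)
    (v : Fin N → Fin N → OrderedAbelianGroup.Carrier G) →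
    Problem.HasSpanningTree G arc v →
    (k : ℕ) → 2 ≤ k → k ≤ N →
    ∀ F → Problem.Optimal G arc v (k ∸ 1) F →
    ∀ E → Problem.IsAtom G arc v k E →
    InducedIsTree F E
theorem6 G N arc v _ (suc k) _ _ F optF E atom = Main.inducedIsTree G arc v optF atom
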